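{- Let $m,n\ge1$ and $b\in[-1,1]^m$. Let $q^*$ and $q_*$ be the supervertex and subvertex of $P(b)$, and let $F:\mathcal L^n\to\mathbb R$ be a truncated $\ell$-positive function which is symmetric. Then for any $0\le k\le n$ and any $\omega\in\mathcal L^{n-k}$: (a) If $b$ is decreasing, i.e. $b(1)\ge\dots\ge b(m)$, then $$E_{q^*}(F_{\omega- })=\sum_{i_0+\dots+i_m=k}\frac{k!}{i_0!\cdots i_m!}\, b'(0)^{i_0}\cdots b'(m)^{i_m}\, F(\omega\mu_0^{i_0}\cdots\mu_m^{i_m}).$$ (b) If $q_*\in P(b)$ then $$E_{q_*}(F_{\omega- })=\sum_{i_0+\dots+i_m=k}\frac{k!}{i_0!\cdots i_m!}\, b''(0)^{i_0}\cdots b''(m)^{i_m}\, F(\omega\nu_0^{i_0}\cdots\nu_m^{i_m}).$$ The sums run over tuples of non-negative integers $(i_0,\dots,i_m)$ with sum $k$.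
   Context: Fix an integer $m\ge1$. $\mathcal L$ is the set of all functions $\lambda:\{1,\dots,m\}\to\{0,1\}$, with the convention $\lambda(0)=0$. $\mathbb R^{\mathcal L}$ is the space of functions $\mathcal L\to\mathbb R$ with standard basis $\{e_\lambda\}$ and standard inner product $\langle\ ,\ \rangle$. For $0\le i\le m$ let $\ell_i(\lambda)=(-1)^{\lambda(i)}$. For $b\in\mathbb R^m$, $P(b)=\{x\in\mathbb R^{\mathcal L}: x(\lambda)\ge 0\ \forall\lambda,\ \langle \ell_0,x\rangle=1,\ \langle \ell_i,x\rangle=b(i)\text{ for }1\le i\le m\}$, a set of probability density functions on $\mathcal L$. Truncation: $t^+=\max\{t,0\}$ for $t\in\mathbb R$, and $v^+(\lambda)=v(\lambda)^+$ for $v\in\mathbb R^{\mathcal L}$. $U_{\ell\text{ -pos}}$ is the set of vectors $\sum_{i=0}^m a_i\ell_i$ with $a_1,\dots,a_m>0$ ($a_0\in\mathbb R$ arbitrary), and $(U_{\ell\text{ -pos}})^+=\{\sum_{i=1}^k u_i^+ : u_i\in U_{\ell\text{ -pos}},\ k\ge0\}$. Elements of $\mathcal L^k$ are regarded as words of length $k$ in the alphabet $\mathcal L$; juxtaposition is concatenation, and $\lambda^j$ denotes the word $\lambda\cdots\lambda$ of length $j$. $F:\mathcal L^n\to\mathbb R$ is symmetric if $F(\lambda_1\cdots\lambda_n)$ is independent of the order of the $\lambda_i$. It is truncated $\ell$-positive if for all words $\omega,\tau$ of total length $n-1$ the function $\lambda\mapsto F(\omega\lambda\tau)$ belongs to $(U_{\ell\text{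 -pos}})^+$. For $\omega\in\mathcal L^{n-k}$, $F_{\omega- }:\mathcal L^k\to\mathbb R$ is $F_{\omega- }(\tau)=F(\omega\tau)$. For a density $p$ on $\mathcal L$, $E_p$ of a function on $\mathcal L^k$ is the expectation with respect to the product measure $p^{\otimes k}$. For $b\in[-1,1]^m$ put $b(0)=1$, $b(m+1)=-1$. $b'(i)=\frac{b(i)-b(i+1)}2$ for $0\le i\le m$. $\mu_i\in\mathcal L$ ($0\le i\le m$): $\mu_i(k)=0$ if $k\le i$, $\mu_i(k)=1$ if $k\ge i+1$. If $b$ is decreasing the supervertex of $P(b)$ is $q^*=\sum_{i=0}^m b'(i)e_{\mu_i}$ (it is an element of $P(b)$). $\nu_i\in\mathcal L$ ($0\le i\le m$): $\nu_i(j)=1-\delta_{ij}$ for $1\le j\le m$. $b''(i)=\frac{b(i)+1}{2}$ for $1\le i\le m$ and $b''(0)=1-\sum_{i=1}^m b''(i)$. The subvertex is $q_*=\sum_{i=0}^m b''(i)e_{\nu_i}\in\mathbb R^{\mathcal L}$ (in general not in $P(b)$). Convention: $0^0=1$. -}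

module Defs where

open import Algebra.Bundles using (RawRing)
open import Data.Bool using (Bool; true; false; if_then_else_; not)
import Data.Bool.Properties as Bool
open import Data.Fin using (Fin; zero; suc; toℕ; inject₁)
import Data.Fin as Fin
import Data.Fin.Properties as Fin
open import Data.Integer using (+_)
open import Data.List using (List; []; _∷_; foldr; map; concatMap; cartesianProductWith; allFin)
open import Data.List.Relation.Binary.Permutation.Propositional using (_↭_)
open import Data.Nat using (ℕ; zero; suc; _∸_; _!; NonZero)
import Data.Nat as ℕ
import Data.Nat.Properties as ℕ
open import Data.Product using (Σ; Σ-syntax; ∃; ∃-syntax; _×_; _,_)
open import Data.Rational using (ℚ; 0ℚ; 1ℚ; ½; ∣_∣)
import Data.Rational as ℚ
import Data.Rational.Properties as ℚ
open import Data.Rational.Solver using (module +-*-Solver)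
open import Data.Sum using (inj₁; inj₂)
open import Data.Vec using (Vec; []; _∷_; _∷ʳ_; _++_; cast; lookup; replicate; tabulate; toList)
import Data.Vec as Vec
import Data.Vec.Properties as Vec
open import Function using (_∘_)
open import Level using (0ℓ)
open import Relation.Binary using (DecidableEquality)
open import Relation.Binary.PropositionalEquality
  using (_≡_; refl; sym; trans; cong; cong₂; subst)
open import Relation.Nullary using (does)

------------------------------------------------------------------------
-- Estimates in ℚ

module _ where
  open +-*-Solver
  open ℚ.≤-Reasoning

  half-pos : ∀ {ε} → 0ℚ ℚ.< ε → 0ℚ ℚ.< ½ ℚ.* ε
  half-pos {ε} 0<ε = ℚ.*-monoʳ-<-pos ½ 0<ε

  halves : ∀ ε → ½ ℚ.* ε ℚ.+ ½ ℚ.* ε ≡ ε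
  halves = solve 1 (λ e → con ½ :* e :+ con ½ :* e := e) refl

  p≤∣p∣ : ∀ p → p ℚ.≤ ∣ p ∣
  p≤∣p∣ p with ℚ.≤-total 0ℚ p
  ... | inj₁ 0≤p = ℚ.≤-reflexive (sym (ℚ.0≤p⇒∣p∣≡p 0≤p))
  ... | inj₂ p≤0 = ℚ.≤-trans p≤0 (ℚ.0≤∣p∣ p)

  split : ∀ p q → p ≡ q ℚ.+ (p ℚ.- q)
  split = solve 2 (λ p q → p := q :+ (p :- q)) refl

  p≤q+∣p-q∣ : ∀ p q → p ℚ.≤ q ℚ.+ ∣ p ℚ.- q ∣
  p≤q+∣p-q∣ p q = begin
    p                    ≡⟨ split p q ⟩
    q ℚ.+ (p ℚ.- q)      ≤⟨ ℚ.+-monoʳ-≤ q (p≤∣p∣ (p ℚ.- q)) ⟩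
    q ℚ.+ ∣ p ℚ.- q ∣    ∎

  ∣p-q∣≡∣q-p∣ : ∀ p q → ∣ p ℚ.- q ∣ ≡ ∣ q ℚ.- p ∣
  ∣p-q∣≡∣q-p∣ p q = trans
    (cong ∣_∣ (solve 2 (λ p q → p :- q := :- (q :- p)) refl p q))
    (ℚ.∣-p∣≡∣p∣ (q ℚ.- p))

  p<q+ε⇒p-q<ε : ∀ {p q ε} → p ℚ.< q ℚ.+ ε → p ℚ.- q ℚ.< ε
  p<q+ε⇒p-q<ε {p} {q} {ε} p<q+ε = begin-strict
    p ℚ.- q              <⟨ ℚ.+-monoˡ-< (ℚ.- q) p<q+ε ⟩
    (q ℚ.+ ε) ℚ.- q      ≡⟨ solve 2 (λ q e → (q :+ e) :- q := e) refl q ε ⟩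
    ε                    ∎

  near : ∀ {p q ε} → p ℚ.< q ℚ.+ ε → q ℚ.< p ℚ.+ ε → ∣ p ℚ.- q ∣ ℚ.< ε
  near {p} {q} {ε} p<q+ε q<p+ε with ℚ.∣p∣≡p∨∣p∣≡-p (p ℚ.- q)
  ... | inj₁ eq = subst (ℚ._< ε) (sym eq) (p<q+ε⇒p-q<ε p<q+ε)
  ... | inj₂ eq = subst (ℚ._< ε)
    (sym (trans eq (solve 2 (λ p q → :- (p :- q) := q :- p) refl p q)))
    (p<q+ε⇒p-q<ε q<p+ε)

  +-near : ∀ a b c d {ε} → ∣ a ℚ.- c ∣ ℚ.< ½ ℚ.* ε → ∣ b ℚ.- d ∣ ℚ.< ½ ℚ.* ε →
           ∣ (a ℚ.+ b) ℚ.- (c ℚ.+ d) ∣ ℚ.< ε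
  +-near a b c d {ε} p q = begin-strict
    ∣ (a ℚ.+ b) ℚ.- (c ℚ.+ d) ∣
      ≡⟨ cong ∣_∣ (solve 4 (λ a b c d → (a :+ b) :- (c :+ d) := (a :- c) :+ (b :- d))
           refl a b c d) ⟩
    ∣ (a ℚ.- c) ℚ.+ (b ℚ.- d) ∣        ≤⟨ ℚ.∣p+q∣≤∣p∣+∣q∣ (a ℚ.- c) (b ℚ.- d) ⟩
    ∣ a ℚ.- c ∣ ℚ.+ ∣ b ℚ.- d ∣        <⟨ ℚ.+-mono-< p q ⟩
    ½ ℚ.* ε ℚ.+ ½ ℚ.* ε                ≡⟨ halves ε ⟩
    ε                                  ∎

  neg-near : ∀ a c {ε} → ∣ a ℚ.- c ∣ ℚ.< ε → ∣ ℚ.- a ℚ.- ℚ.- c ∣ ℚ.< ε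
  neg-near a c {ε} = subst (ℚ._< ε)
    (trans (∣p-q∣≡∣q-p∣ a c)
      (cong ∣_∣ (solve 2 (λ a c → c :- a := :- a :- :- c) refl a c)))

  ⊔-near : ∀ a b c d {ε} → ∣ a ℚ.- c ∣ ℚ.< ε → ∣ b ℚ.- d ∣ ℚ.< ε →
           ∣ (a ℚ.⊔ b) ℚ.- (c ℚ.⊔ d) ∣ ℚ.< ε
  ⊔-near a b c d {ε} p q = near (half a b c d p q)
    (half c d a b (subst (ℚ._< ε) (∣p-q∣≡∣q-p∣ a c) p) (subst (ℚ._< ε) (∣p-q∣≡∣q-p∣ b d) q))
    where
    half : ∀ a b c d → ∣ a ℚ.- c ∣ ℚ.< ε → ∣ b ℚ.- d ∣ ℚ.< ε → a ℚ.⊔ b ℚ.< (c ℚ.⊔ d) ℚ.+ ε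
    half a b c d p q with ℚ.⊔-sel a b
    ... | inj₁ eq = subst (ℚ._< (c ℚ.⊔ d) ℚ.+ ε) (sym eq)
      (ℚ.≤-<-trans (p≤q+∣p-q∣ a c) (ℚ.+-mono-≤-< (ℚ.p≤p⊔q c d) p))
    ... | inj₂ eq = subst (ℚ._< (c ℚ.⊔ d) ℚ.+ ε) (sym eq)
      (ℚ.≤-<-trans (p≤q+∣p-q∣ b d) (ℚ.+-mono-≤-< (ℚ.p≤q⊔p c d) q))

  *-modulus : ∀ B → 0ℚ ℚ.< B → ∀ {ε} → 0ℚ ℚ.< ε →
    Σ[ δ ∈ ℚ ] 0ℚ ℚ.< δ × (∀ a b c d → ∣ a ∣ ℚ.< B → ∣ d ∣ ℚ.< B →
      ∣ a ℚ.- c ∣ ℚ.< δ → ∣ b ℚ.- d ∣ ℚ.< δ → ∣ a ℚ.* b ℚ.- c ℚ.* d ∣ ℚ.< ε)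
  *-modulus B 0<B {ε} 0<ε = δ , 0<δ , bound
    where
    instance
      B-pos : ℚ.Positive B
      B-pos = ℚ.positive 0<B
      B-nonNeg : ℚ.NonNegative B
      B-nonNeg = ℚ.pos⇒nonNeg B
      B≢0 : ℚ.NonZero B
      B≢0 = ℚ.pos⇒nonZero B
      1/B-pos : ℚ.Positive (ℚ.1/ B)
      1/B-pos = ℚ.1/pos⇒pos B

    δ : ℚ
    δ = ℚ.1/ B ℚ.* (½ ℚ.* ε)

    0<δ : 0ℚ ℚ.< δ
    0<δ = subst (ℚ._< δ) (ℚ.*-zeroʳ (ℚ.1/ B)) (ℚ.*-monoʳ-<-pos (ℚ.1/ B) (half-pos 0<ε))

    Bδ : B ℚ.* δ ≡ ½ ℚ.* ε
    Bδ = trans (sym (ℚ.*-assoc B (ℚ.1/ B) (½ ℚ.* ε)))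
      (trans (cong (ℚ._* (½ ℚ.* ε)) (ℚ.*-inverseʳ B)) (ℚ.*-identityˡ (½ ℚ.* ε)))

    product-small : ∀ p q → ∣ p ∣ ℚ.< B → ∣ q ∣ ℚ.< δ → ∣ p ℚ.* q ∣ ℚ.< ½ ℚ.* ε
    product-small p q p<B q<δ = begin-strict
      ∣ p ℚ.* q ∣          ≡⟨ ℚ.∣p*q∣≡∣p∣*∣q∣ p q ⟩
      ∣ p ∣ ℚ.* ∣ q ∣      ≤⟨ ℚ.*-monoʳ-≤-nonNeg ∣ q ∣ {{ℚ.nonNegative (ℚ.0≤∣p∣ q)}}
                                (ℚ.<⇒≤ p<B) ⟩
      B ℚ.* ∣ q ∣          <⟨ ℚ.*-monoʳ-<-pos B q<δ ⟩
      B ℚ.* δ              ≡⟨ Bδ ⟩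
      ½ ℚ.* ε              ∎

    bound : ∀ a b c d → ∣ a ∣ ℚ.< B → ∣ d ∣ ℚ.< B →
      ∣ a ℚ.- c ∣ ℚ.< δ → ∣ b ℚ.- d ∣ ℚ.< δ → ∣ a ℚ.* b ℚ.- c ℚ.* d ∣ ℚ.< ε
    bound a b c d a<B d<B p q = begin-strict
      ∣ a ℚ.* b ℚ.- c ℚ.* d ∣
        ≡⟨ cong ∣_∣ (solve 4 (λ a b c d → a :* b :- c :* d := a :* (b :- d) :+ d :* (a :- c))
             refl a b c d) ⟩
      ∣ a ℚ.* (b ℚ.- d) ℚ.+ d ℚ.* (a ℚ.- c) ∣
        ≤⟨ ℚ.∣p+q∣≤∣p∣+∣q∣ (a ℚ.* (b ℚ.- d)) (d ℚ.* (a ℚ.- c)) ⟩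
      ∣ a ℚ.* (b ℚ.- d) ∣ ℚ.+ ∣ d ℚ.* (a ℚ.- c) ∣
        <⟨ ℚ.+-mono-< (product-small a (b ℚ.- d) a<B q) (product-small d (a ℚ.- c) d<B p) ⟩
      ½ ℚ.* ε ℚ.+ ½ ℚ.* ε
        ≡⟨ halves ε ⟩
      ε ∎

------------------------------------------------------------------------
-- Real numbers: Cauchy sequences of rationals, compared by the setoid
-- equality _≈_ (the difference is a null sequence)

Cauchy : (ℕ → ℚ) → Set
Cauchy s = ∀ {ε} → 0ℚ ℚ.< ε →
  ∃[ N ] ∀ {i j} → N ℕ.≤ i → N ℕ.≤ j → ∣ s i ℚ.- s j ∣ ℚ.< ε

record ℝ : Set where
  constructor mkℝ
  field
    seq    : ℕ → ℚ
    cauchy : Cauchy seq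
open ℝ public

infix 4 _≈_ _≤_ _<_
infixl 6 _+_ _-_
infixl 7 _*_
infix 8 -_

record _≈_ (x y : ℝ) : Set where
  constructor mk≈
  field
    null : ∀ {ε} → 0ℚ ℚ.< ε →
           ∃[ N ] ∀ {i} → N ℕ.≤ i → ∣ seq x i ℚ.- seq y i ∣ ℚ.< ε

record _≤_ (x y : ℝ) : Set where
  constructor mk≤
  field
    bounded : ∀ {ε} → 0ℚ ℚ.< ε →
              ∃[ N ] ∀ {i} → N ℕ.≤ i → seq x i ℚ.≤ seq y i ℚ.+ ε

record _<_ (x y : ℝ) : Set where
  constructor mk<
  field
    gap       : ℚ
    0<gap     : 0ℚ ℚ.< gap
    separated : ∃[ N ] ∀ {i} → N ℕ.≤ i → seq x i ℚ.+ gap ℚ.≤ seq y i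

abstract
  const-cauchy : ∀ p → Cauchy (λ _ → p)
  const-cauchy p {ε} 0<ε =
    0 , λ _ _ → subst (λ q → ∣ q ∣ ℚ.< ε) (sym (ℚ.+-inverseʳ p)) 0<ε

  +-cauchy : ∀ x y → Cauchy (λ i → seq x i ℚ.+ seq y i)
  +-cauchy x y 0<ε =
    let M , hx = cauchy x (half-pos 0<ε)
        N , hy = cauchy y (half-pos 0<ε)
    in M ℕ.⊔ N , λ {i} {j} p q → +-near (seq x i) (seq y i) (seq x j) (seq y j)
         (hx (ℕ.m⊔n≤o⇒m≤o M N p) (ℕ.m⊔n≤o⇒m≤o M N q))
         (hy (ℕ.m⊔n≤o⇒n≤o M N p) (ℕ.m⊔n≤o⇒n≤o M N q))

  neg-cauchy : ∀ x → Cauchy (λ i → ℚ.- seq x i)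
  neg-cauchy x 0<ε =
    let N , hx = cauchy x 0<ε
    in N , λ {i} {j} p q → neg-near (seq x i) (seq x j) (hx p q)

  max-cauchy : ∀ x y → Cauchy (λ i → seq x i ℚ.⊔ seq y i)
  max-cauchy x y 0<ε =
    let M , hx = cauchy x 0<ε
        N , hy = cauchy y 0<ε
    in M ℕ.⊔ N , λ {i} {j} p q → ⊔-near (seq x i) (seq y i) (seq x j) (seq y j)
         (hx (ℕ.m⊔n≤o⇒m≤o M N p) (ℕ.m⊔n≤o⇒m≤o M N q))
         (hy (ℕ.m⊔n≤o⇒n≤o M N p) (ℕ.m⊔n≤o⇒n≤o M N q))

  eventually-bounded : (x : ℝ) →
    Σ[ B ∈ ℚ ] 0ℚ ℚ.< B × (∃[ N ] ∀ {i} → N ℕ.≤ i → ∣ seq x i ∣ ℚ.< B)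
  eventually-bounded x with cauchy x (ℚ.positive⁻¹ 1ℚ)
  ... | N , h = ∣ seq x N ∣ ℚ.+ 1ℚ
              , ℚ.+-mono-≤-< (ℚ.0≤∣p∣ (seq x N)) (ℚ.positive⁻¹ 1ℚ)
              , N , λ {i} N≤i → begin-strict
    ∣ seq x i ∣                                ≡⟨ cong ∣_∣ (split (seq x i) (seq x N)) ⟩
    ∣ seq x N ℚ.+ (seq x i ℚ.- seq x N) ∣      ≤⟨ ℚ.∣p+q∣≤∣p∣+∣q∣ (seq x N) (seq x i ℚ.- seq x N) ⟩
    ∣ seq x N ∣ ℚ.+ ∣ seq x i ℚ.- seq x N ∣    <⟨ ℚ.+-monoʳ-< ∣ seq x N ∣ (h N≤i ℕ.≤-refl) ⟩
    ∣ seq x N ∣ ℚ.+ 1ℚ                         ∎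
    where
    open ℚ.≤-Reasoning

  *-cauchy : ∀ x y → Cauchy (λ i → seq x i ℚ.* seq y i)
  *-cauchy x y 0<ε =
    let A , 0<A , K , hA = eventually-bounded x
        B , 0<B , L , hB = eventually-bounded y
        δ , 0<δ , small  = *-modulus (A ℚ.⊔ B) (ℚ.<-≤-trans 0<A (ℚ.p≤p⊔q A B)) 0<ε
        M , hx = cauchy x 0<δ
        N , hy = cauchy y 0<δ
        KL = K ℕ.⊔ L
        MN = M ℕ.⊔ N
    in KL ℕ.⊔ MN , λ {i} {j} p q →
         let p₁ = ℕ.m⊔n≤o⇒m≤o KL MN p
             p₂ = ℕ.m⊔n≤o⇒n≤o KL MN p
             q₁ = ℕ.m⊔n≤o⇒m≤o KL MN q
             q₂ = ℕ.m⊔n≤o⇒n≤o KL MN q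
         in small (seq x i) (seq y i) (seq x j) (seq y j)
              (ℚ.<-≤-trans (hA (ℕ.m⊔n≤o⇒m≤o K L p₁)) (ℚ.p≤p⊔q A B))
              (ℚ.<-≤-trans (hB (ℕ.m⊔n≤o⇒n≤o K L q₁)) (ℚ.p≤q⊔p A B))
              (hx (ℕ.m⊔n≤o⇒m≤o M N p₂) (ℕ.m⊔n≤o⇒m≤o M N q₂))
              (hy (ℕ.m⊔n≤o⇒n≤o M N p₂) (ℕ.m⊔n≤o⇒n≤o M N q₂))

fromℚ : ℚ → ℝ
fromℚ p = mkℝ (λ _ → p) (const-cauchy p)

0ℝ 1ℝ ½ℝ : ℝ
0ℝ = fromℚ 0ℚ
1ℝ = fromℚ 1ℚ
½ℝ = fromℚ ½

_+_ _*_ max : ℝ → ℝ → ℝ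
x + y   = mkℝ (λ i → seq x i ℚ.+ seq y i) (+-cauchy x y)
x * y   = mkℝ (λ i → seq x i ℚ.* seq y i) (*-cauchy x y)
max x y = mkℝ (λ i → seq x i ℚ.⊔ seq y i) (max-cauchy x y)

-_ : ℝ → ℝ
- x = mkℝ (λ i → ℚ.- seq x i) (neg-cauchy x)

_-_ : ℝ → ℝ → ℝ
x - y = x + - y

ℝ-rawRing : RawRing 0ℓ 0ℓ
ℝ-rawRing = record
  { Carrier = ℝ
  ; _≈_     = _≈_
  ; _+_     = _+_
  ; _*_     = _*_
  ; -_      = -_
  ; 0#      = 0ℝ
  ; 1#      = 1ℝ
  }

-- sum and product run over functions Fin r → ℝ; x ^ 0 reduces to 1ℝ.
open import Algebra.Definitions.RawSemiring (RawRing.rawSemiring ℝ-rawRing) public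
  using (sum; product; _^_)

infix 5 ∑
∑ : {A : Set} → List A → (A → ℝ) → ℝ
∑ xs f = foldr _+_ 0ℝ (map f xs)

syntax ∑ xs (λ x → e) = ∑[ x ∈ xs ] e

------------------------------------------------------------------------
-- Finite enumerations

allVectors : {A : Set} → List A → (k : ℕ) → List (Vec A k)
allVectors xs zero    = [] ∷ []
allVectors xs (suc k) = cartesianProductWith _∷_ xs (allVectors xs k)

record Tuple (r k : ℕ) : Set where
  constructor mkTuple
  field
    entries   : Vec ℕ r
    .sum-is-k : Vec.sum entries ≡ k
open Tuple public using (entries)

consTuple : ∀ {r k} (j : Fin (suc k)) → Tuple r (k ∸ toℕ j) → Tuple (suc r) k
consTuple j (mkTuple i s) =
  mkTuple (toℕ j ∷ i) (trans (cong (toℕ j ℕ.+_) s) (ℕ.m+[n∸m]≡n (Fin.toℕ≤pred[n] j)))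

-- Every r-tuple of natural numbers with sum k, each listed once.
tuples : (r k : ℕ) → List (Tuple r k)
tuples zero    zero    = mkTuple [] refl ∷ []
tuples zero    (suc k) = []
tuples (suc r) k       = concatMap (λ j → map (consTuple j) (tuples r (k ∸ toℕ j))) (allFin (suc k))

∏! : ∀ {r} → Vec ℕ r → ℕ
∏! []      = 1
∏! (j ∷ i) = j ! ℕ.* ∏! i

∏!≢0 : ∀ {r} (i : Vec ℕ r) → NonZero (∏! i)
∏!≢0 []      = _
∏!≢0 (j ∷ i) = ℕ.m*n≢0 (j !) (∏! i) {{j ℕ.!≢0}} {{∏!≢0 i}}

multinomial : ∀ {r k} → Tuple r k → ℝ
multinomial {k = k} t = fromℚ (ℚ._/_ (+ (k !)) (∏! (entries t)) {{∏!≢0 (entries t)}})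

-- κ(0)^{i_0} κ(1)^{i_1} ⋯
blocks : ∀ {A : Set} {r} (i : Vec ℕ r) → (Fin r → A) → Vec A (Vec.sum i)
blocks []      κ = []
blocks (j ∷ i) κ = replicate j (κ zero) ++ blocks i (κ ∘ suc)

powerWord : ∀ {A : Set} {r k} → (Fin r → A) → Tuple r k → Vec A k
powerWord κ (mkTuple i s) = cast s (blocks i κ)

------------------------------------------------------------------------
-- Functions λ : {1,…,m} → {0,1}, as bit vectors; position zero of
-- Fin m stands for 1 ∈ {1,…,m}.

𝓛 : ℕ → Set
𝓛 m = Vec Bool m

_≟𝓛_ : ∀ {m} → DecidableEquality (𝓛 m)
_≟𝓛_ = Vec.≡-dec Bool._≟_

all𝓛 : ∀ m → List (𝓛 m)
all𝓛 m = allVectors (false ∷ true ∷ []) m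

Word : ℕ → ℕ → Set
Word m k = Vec (𝓛 m) k

ℝ^𝓛 : ℕ → Set
ℝ^𝓛 m = 𝓛 m → ℝ

e : ∀ {m} → 𝓛 m → ℝ^𝓛 m
e κ l = if does (κ ≟𝓛 l) then 1ℝ else 0ℝ

⟨_,_⟩ : ∀ {m} → ℝ^𝓛 m → ℝ^𝓛 m → ℝ
⟨_,_⟩ {m} u v = ∑[ l ∈ all𝓛 m ] (u l * v l)

-- The prepended false is the convention λ(0) = 0.
ℓ : ∀ {m} → Fin (suc m) → ℝ^𝓛 m
ℓ i l = if lookup (false ∷ l) i then - 1ℝ else 1ℝ

record _∈P_ {m} (x : ℝ^𝓛 m) (b : Vec ℝ m) : Set where
  field
    nonnegative : ∀ l → 0ℝ ≤ x l
    total       : ⟨ ℓ zero , x ⟩ ≈ 1ℝ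
    marginal    : ∀ i → ⟨ ℓ (suc i) , x ⟩ ≈ lookup b i

_⁺ : ∀ {m} → ℝ^𝓛 m → ℝ^𝓛 m
(v ⁺) l = max (v l) 0ℝ

U-ℓ-pos : ∀ {m} → ℝ^𝓛 m → Set
U-ℓ-pos {m} u = Σ[ a ∈ (Fin (suc m) → ℝ) ]
  (∀ i → 0ℝ < a (suc i)) × (∀ l → u l ≈ sum (λ i → a i * ℓ i l))

U-ℓ-pos⁺ : ∀ {m} → ℝ^𝓛 m → Set
U-ℓ-pos⁺ {m} f = ∃[ k ] Σ[ u ∈ (Fin k → ℝ^𝓛 m) ]
  (∀ i → U-ℓ-pos (u i)) × (∀ l → f l ≈ sum (λ i → (u i ⁺) l))

Symmetric : ∀ {m n} → (Word m n → ℝ) → Set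
Symmetric F = ∀ v w → toList v ↭ toList w → F v ≈ F w

TruncatedℓPositive : ∀ {m n} → (Word m n → ℝ) → Set
TruncatedℓPositive {m} {n} F =
  ∀ {r s} .(eq : r ℕ.+ suc s ≡ n) (ω : Word m r) (τ : Word m s) →
  U-ℓ-pos⁺ (λ l → F (cast eq (ω ++ l ∷ τ)))

-- F_{ω-}
restrict : ∀ {m n k} → (Word m n → ℝ) → .(k ℕ.≤ n) → Word m (n ∸ k) → Word m k → ℝ
restrict F k≤n ω τ = F (cast (ℕ.m∸n+n≡m k≤n) (ω ++ τ))

𝔼 : ∀ {m k} → ℝ^𝓛 m → (Word m k → ℝ) → ℝ
𝔼 {m} {k} p G = ∑[ τ ∈ allVectors (all𝓛 m) k ] (product (λ j → p (lookup τ j)) * G τ)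

Decreasing : ∀ {m} → Vec ℝ m → Set
Decreasing b = ∀ i j → i Fin.≤ j → lookup b j ≤ lookup b i

-- b(0), b(1), …, b(m), b(m+1)
extend : ∀ {m} → Vec ℝ m → Vec ℝ (suc (suc m))
extend b = 1ℝ ∷ (b ∷ʳ (- 1ℝ))

b′ : ∀ {m} → Vec ℝ m → Fin (suc m) → ℝ
b′ b i = ½ℝ * (lookup (extend b) (inject₁ i) - lookup (extend b) (suc i))

μ : ∀ {m} → Fin (suc m) → 𝓛 m
μ i = tabulate (λ k → does (suc (toℕ i) ℕ.≤? suc (toℕ k)))

supervertex : ∀ {m} → Vec ℝ m → ℝ^𝓛 m
supervertex b l = sum (λ i → b′ b i * e (μ i) l)

ν : ∀ {m} → Fin (suc m) → 𝓛 m
ν i = tabulate (λ j → not (does (i Fin.≟ suc j)))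

b″-pos : ∀ {m} → Vec ℝ m → Fin m → ℝ
b″-pos b i = ½ℝ * (lookup b i + 1ℝ)

b″ : ∀ {m} → Vec ℝ m → Fin (suc m) → ℝ
b″ b zero    = 1ℝ - sum (b″-pos b)
b″ b (suc i) = b″-pos b i

subvertex : ∀ {m} → Vec ℝ m → ℝ^𝓛 m
subvertex b l = sum (λ i → b″ b i * e (ν i) l)

{-# OPTIONS --safe #-}

-- For a density p = Σ_i c_i e_{κ_i} the
-- expectation of G is the iterated sum of c_{i_1} ⋯ c_{i_k} G(κ_{i_1} ⋯ κ_{i_k}),
-- and for symmetric G it is collected into a multinomial sum by induction on the
-- number of points: splitting off κ_0 is the binomial theorem, proved by Pascal's rule.

module Submission where

open import Algebra.Bundles using (CommutativeMonoid; CommutativeSemiring)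
import Algebra.Definitions.RawSemiring as RawSemiringDefinitions
open import Algebra.Morphism.Structures using (IsSemiringHomomorphism)
import Algebra.Properties.CommutativeSemigroup as CommutativeSemigroupProperties
import Algebra.Properties.Semiring.Sum as SemiringSum
open import Algebra.Structures.Biased using (isCommutativeMonoidˡ; isCommutativeSemiringˡ)
open import Data.Bool using (Bool; false; true)
open import Data.Fin using (Fin; zero; suc; toℕ)
import Data.Fin.Properties as Fin
open import Data.Integer using (+_)
import Data.Integer as ℤ
import Data.Integer.Properties as ℤ
open import Data.List as List using (List; []; _∷_; _++_; concatMap; cartesianProductWith; allFin)
import Data.List.Properties as List
open import Data.List.Relation.Binary.Permutation.Propositional
  using (_↭_; prep; ↭-reflexive; ↭-sym; ↭-trans)
open import Data.List.Relation.Binary.Permutation.Propositional.Properties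
  using (++⁺ˡ; shift; ↭-length)
open import Data.Nat using (ℕ; zero; suc; _∸_; _!; NonZero)
open import Data.Nat as ℕ using ()
open import Data.Nat.Combinatorics
  using (_C_; nCk≡n!/k![n-k]!; k![n∸k]!∣n!; k>n⇒nCk≡0; nCk+nC[k+1]≡[n+1]C[k+1])
open import Data.Nat.DivMod using (m/n*n≡m)
import Data.Nat.Properties as ℕ
open import Data.Nat.Solver using (module +-*-Solver)
open import Data.Product using (_×_; _,_)
open import Data.Rational using (ℚ; 1ℚ; ∣_∣)
import Data.Rational as ℚ
import Data.Rational.Properties as ℚ
import Data.Rational.Solver as ℚ
open import Data.Rational.Unnormalised using (mkℚᵘ; *≡*)
import Data.Rational.Unnormalised as ℚᵘ
import Data.Rational.Unnormalised.Properties as ℚᵘ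
open import Data.Vec as Vec using (Vec; []; _∷_; lookup; cast; toList; fromList)
import Data.Vec.Properties as Vec
open import Function using (_∘_)
open import Level using (0ℓ)
open import Relation.Binary using (IsEquivalence)
open import Relation.Binary.PropositionalEquality as ≡ using (_≡_)
import Relation.Binary.Reasoning.Setoid as SetoidReasoning
open import Relation.Nullary using (yes; no; contradiction)
open import Defs
  using (Tuple; mkTuple; entries; consTuple; tuples; allVectors; ∏!; ∏!≢0; blocks; powerWord)

-- Binomial and multinomial coefficients

module _ where
  open ℚᵘ.≃-Reasoning

  -- A normalised fraction reduces by a gcd, which obstructs computation. Unnormalised fractions are
  -- compared by cross-multiplication, so identities of fractions are moved there and pulled back by
  -- injectivity.
  toℚᵘ-/ : ∀ a d .{{_ : NonZero d}} → ℚ.toℚᵘ (+ a ℚ./ d) ℚᵘ.≃ + a ℚᵘ./ d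
  toℚᵘ-/ a (suc d) = ℚ.toℚᵘ-fromℚᵘ (mkℚᵘ (+ a) d)

  /1-homo-+ : ∀ a b → (+ a ℚ./ 1) ℚ.+ (+ b ℚ./ 1) ≡ + (a ℕ.+ b) ℚ./ 1
  /1-homo-+ a b = ℚ.toℚᵘ-injective (begin
    ℚ.toℚᵘ ((+ a ℚ./ 1) ℚ.+ (+ b ℚ./ 1))            ≈⟨ ℚ.toℚᵘ-homo-+ (+ a ℚ./ 1) (+ b ℚ./ 1) ⟩
    ℚ.toℚᵘ (+ a ℚ./ 1) ℚᵘ.+ ℚ.toℚᵘ (+ b ℚ./ 1)      ≈⟨ ℚᵘ.+-cong (toℚᵘ-/ a 1) (toℚᵘ-/ b 1) ⟩
    -- The unnormalised sum has numerator `a * 1 + b * 1`; its denominator `1 * 1` computes.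
    (+ a ℚᵘ./ 1) ℚᵘ.+ (+ b ℚᵘ./ 1)                  ≡⟨ ≡.cong₂ (λ x y → (x ℤ.+ y) ℚᵘ./ 1) (ℤ.*-identityʳ (+ a)) (ℤ.*-identityʳ (+ b)) ⟩
    + (a ℕ.+ b) ℚᵘ./ 1                              ≈⟨ toℚᵘ-/ (a ℕ.+ b) 1 ⟨
    ℚ.toℚᵘ (+ (a ℕ.+ b) ℚ./ 1)                      ∎)

  /1-*-/ : ∀ c a d a′ d′ .{{_ : NonZero d}} .{{_ : NonZero d′}} → c ℕ.* a ℕ.* d′ ≡ a′ ℕ.* d →
           (+ c ℚ./ 1) ℚ.* (+ a ℚ./ d) ≡ + a′ ℚ./ d′
  /1-*-/ c a (suc d) a′ (suc d′) eq = ℚ.toℚᵘ-injective (begin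
    ℚ.toℚᵘ ((+ c ℚ./ 1) ℚ.* (+ a ℚ./ suc d))         ≈⟨ ℚ.toℚᵘ-homo-* (+ c ℚ./ 1) (+ a ℚ./ suc d) ⟩
    ℚ.toℚᵘ (+ c ℚ./ 1) ℚᵘ.* ℚ.toℚᵘ (+ a ℚ./ suc d)   ≈⟨ ℚᵘ.*-cong (toℚᵘ-/ c 1) (toℚᵘ-/ a (suc d)) ⟩
    (+ c ℚᵘ./ 1) ℚᵘ.* (+ a ℚᵘ./ suc d)               ≈⟨ *≡* cross ⟩
    + a′ ℚᵘ./ suc d′                                 ≈⟨ toℚᵘ-/ a′ (suc d′) ⟨
    ℚ.toℚᵘ (+ a′ ℚ./ suc d′)                         ∎)
    where
    -- The hypothesis moved from ℕ to ℤ, with the denominator `1` of the first factor put back.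
    cross : + c ℤ.* + a ℤ.* + suc d′ ≡ + a′ ℤ.* + (1 ℕ.* suc d)
    cross = ≡.trans (≡.cong (ℤ._* + suc d′) (≡.sym (ℤ.pos-* c a)))
      (≡.trans (≡.sym (ℤ.pos-* (c ℕ.* a) (suc d′)))
      (≡.trans (≡.cong +_ (≡.trans eq (≡.cong (a′ ℕ.*_) (≡.sym (ℕ.*-identityˡ (suc d))))))
        (ℤ.pos-* a′ (1 ℕ.* suc d))))

-- The factorial formula for `n C k` is a truncating quotient; it is exact because the divisor
-- divides `n !`.
nCk*k![n∸k]!≡n! : ∀ {n k} → k ℕ.≤ n → (n C k) ℕ.* (k ! ℕ.* (n ∸ k) !) ≡ n !
nCk*k![n∸k]!≡n! {n} {k} k≤n =
  ≡.trans (≡.cong (ℕ._* (k ! ℕ.* (n ∸ k) !)) (nCk≡n!/k![n-k]! k≤n)) (m/n*n≡m (k![n∸k]!∣n! k≤n))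
  where instance _ = k ℕ.!* (n ∸ k) !≢0

-- `multinomial t` is by definition `fromℚ (multinomialℚ t)`; separating the rational lets the
-- coefficient identities be proved in ℚ.
multinomialℚ : ∀ {r k} → Tuple r k → ℚ
multinomialℚ {k = k} t = ℚ._/_ (+ (k !)) (∏! (entries t)) {{∏!≢0 (entries t)}}

-- The factor `(k ∸ toℕ j) !` cancels between the denominator of the binomial coefficient and the
-- numerator of `multinomialℚ t`.
multinomialℚ-consTuple : ∀ {r k} (j : Fin (suc k)) (t : Tuple r (k ∸ toℕ j)) →
  multinomialℚ (consTuple j t) ≡ (+ (k C toℕ j) ℚ./ 1) ℚ.* multinomialℚ t
multinomialℚ-consTuple {k = k} j (mkTuple i _) = ≡.sym
  (/1-*-/ (k C toℕ j) ((k ∸ toℕ j) !) (∏! i) (k !) (toℕ j ! ℕ.* ∏! i)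
    {{∏!≢0 i}} {{∏!≢0 (toℕ j ∷ i)}}
    (≡.trans (rearrange (k C toℕ j) ((k ∸ toℕ j) !) (toℕ j !) (∏! i))
      (≡.cong (ℕ._* ∏! i) (nCk*k![n∸k]!≡n! (Fin.toℕ≤pred[n] j)))))
  where
  open +-*-Solver
  rearrange : ∀ c a f p → c ℕ.* a ℕ.* (f ℕ.* p) ≡ c ℕ.* (f ℕ.* a) ℕ.* p
  rearrange = solve 4 (λ c a f p → c :* a :* (f :* p) := c :* (f :* a) :* p) ≡.refl

-- Stated for lists because the lengths `k` and `toℕ j + (k ∸ toℕ j)` agree only propositionally;
-- `toList` forgets the casts.
toList-powerWord-consTuple : ∀ {A : Set} {r k} (κ : Fin (suc r) → A) (j : Fin (suc k))
  (t : Tuple r (k ∸ toℕ j)) →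
  toList (powerWord κ (consTuple j t))
    ≡ List.replicate (toℕ j) (κ zero) ++ toList (powerWord (κ ∘ suc) t)
toList-powerWord-consTuple κ j (mkTuple i s) =
  ≡.trans (Vec.toList-cast _ (blocks (toℕ j ∷ i) κ))
  (≡.trans (Vec.toList-++ (Vec.replicate (toℕ j) (κ zero)) (blocks i (κ ∘ suc)))
  (≡.cong₂ _++_ (Vec.toList-replicate (toℕ j) (κ zero))
    (≡.sym (Vec.toList-cast s (blocks i (κ ∘ suc))))))

-- Sums in a commutative semiring

-- Abstracting from ℝ keeps the operations neutral; those of ℝ unfold to sequences,
-- which unification cannot invert.
module FiniteSums (R : CommutativeSemiring 0ℓ 0ℓ) where

  open CommutativeSemiring R hiding (zero)
  open SemiringSum semiring
    using (sum; sum-cong-≋; sum-replicate-zero; ∑-distrib-+; *-distribˡ-sum; *-distribʳ-sum)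
  open RawSemiringDefinitions rawSemiring using (product)
  open SetoidReasoning setoid

  -- The same fold as the list sum of reals, so at ℝ the two agree by definition.
  ∑ : {A : Set} → List A → (A → Carrier) → Carrier
  ∑ xs f = List.foldr _+_ 0# (List.map f xs)

  infix 5 ∑
  syntax ∑ xs (λ x → e) = ∑[ x ∈ xs ] e

  module _ {A : Set} where

    ∑-cong : (xs : List A) {f g : A → Carrier} → (∀ x → f x ≈ g x) → ∑ xs f ≈ ∑ xs g
    ∑-cong []       h = refl
    ∑-cong (x ∷ xs) h = +-cong (h x) (∑-cong xs h)

    ∑-++ : (xs ys : List A) (f : A → Carrier) → ∑ (xs ++ ys) f ≈ ∑ xs f + ∑ ys f
    ∑-++ []       ys f = sym (+-identityˡ _)
    ∑-++ (x ∷ xs) ys f = trans (+-congˡ (∑-++ xs ys f)) (sym (+-assoc _ _ _))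

    ∑-map : {B : Set} (g : B → A) (ys : List B) (f : A → Carrier) → ∑ (List.map g ys) f ≡ ∑ ys (f ∘ g)
    ∑-map g ys f = ≡.cong (List.foldr _+_ 0#) (≡.sym (List.map-∘ ys))

    ∑-concatMap : {B : Set} (g : B → List A) (ys : List B) (f : A → Carrier) →
                  ∑ (concatMap g ys) f ≈ (∑[ y ∈ ys ] ∑ (g y) f)
    ∑-concatMap g []       f = refl
    ∑-concatMap g (y ∷ ys) f =
      trans (∑-++ (g y) (concatMap g ys) f) (+-congˡ (∑-concatMap g ys f))

    ∑-cartesianProductWith : {B D : Set} (g : B → D → A) (xs : List B) (ys : List D) (f : A → Carrier) →
      ∑ (cartesianProductWith g xs ys) f ≈ (∑[ x ∈ xs ] (∑[ y ∈ ys ] f (g x y)))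
    ∑-cartesianProductWith g []       ys f = refl
    ∑-cartesianProductWith g (x ∷ xs) ys f =
      trans (∑-++ (List.map (g x) ys) (cartesianProductWith g xs ys) f)
        (+-cong (reflexive (∑-map (g x) ys f)) (∑-cartesianProductWith g xs ys f))

    *-distribˡ-∑ : (x : Carrier) (xs : List A) (f : A → Carrier) → x * ∑ xs f ≈ (∑[ a ∈ xs ] (x * f a))
    *-distribˡ-∑ x []       f = zeroʳ x
    *-distribˡ-∑ x (a ∷ xs) f = trans (distribˡ x _ _) (+-congˡ (*-distribˡ-∑ x xs f))

    *-distribʳ-∑ : (x : Carrier) (xs : List A) (f : A → Carrier) → ∑ xs f * x ≈ (∑[ a ∈ xs ] (f a * x))
    *-distribʳ-∑ x []       f = zeroˡ x
    *-distribʳ-∑ x (a ∷ xs) f = trans (distribʳ x _ _) (+-congˡ (*-distribʳ-∑ x xs f))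

    ∑-zero : (xs : List A) (f : A → Carrier) → (∀ x → f x ≈ 0#) → ∑ xs f ≈ 0#
    ∑-zero []       f h = refl
    ∑-zero (x ∷ xs) f h = trans (+-cong (h x) (∑-zero xs f h)) (+-identityˡ 0#)

    ∑-sum-comm : ∀ {r} (xs : List A) (f : A → Fin r → Carrier) →
                 (∑[ x ∈ xs ] sum (f x)) ≈ sum (λ i → ∑[ x ∈ xs ] f x i)
    ∑-sum-comm {r} []       f = sym (sum-replicate-zero r)
    ∑-sum-comm     (x ∷ xs) f = trans (+-congˡ (∑-sum-comm xs f)) (sym (∑-distrib-+ (f x) _))

    ∑-tabulate : ∀ {r} (g : Fin r → A) (f : A → Carrier) → ∑ (List.tabulate g) f ≡ sum (f ∘ g)
    ∑-tabulate {zero}  g f = ≡.refl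
    ∑-tabulate {suc r} g f = ≡.cong (λ y → f (g zero) + y) (∑-tabulate (g ∘ suc) f)

  -- Iterated sums and expectations under product measures

  module _ {A : Set} where

    -- For a probability vector `c` this is the expectation over `k` independent letters, `κ i`
    -- having weight `c i`. `H` lives on lists so that a prefix is absorbed into it without changing
    -- its type.
    iteratedSum : ∀ {r} → (Fin r → Carrier) → (Fin r → A) → ℕ → (List A → Carrier) → Carrier
    iteratedSum c κ zero    H = H []
    iteratedSum c κ (suc k) H = sum λ i → c i * iteratedSum c κ k (λ w → H (κ i ∷ w))

    iteratedSum-cong : ∀ {r} (c : Fin r → Carrier) (κ : Fin r → A) k {H H′ : List A → Carrier} →
      (∀ w → H w ≈ H′ w) → iteratedSum c κ k H ≈ iteratedSum c κ k H′
    iteratedSum-cong c κ zero    h = h []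
    iteratedSum-cong c κ (suc k) h =
      sum-cong-≋ λ i → *-congˡ (iteratedSum-cong c κ k (λ w → h (κ i ∷ w)))

    -- A point mass is described by evaluation: summing against `e i` returns the value at `κ i`. If
    -- several `κ i` coincide, their weights add up.
    module _ (xs : List A) {r : ℕ} (c : Fin r → Carrier) (κ : Fin r → A) (e : Fin r → A → Carrier)
             (∑-e : ∀ i (f : A → Carrier) → (∑[ x ∈ xs ] (e i x * f x)) ≈ f (κ i)) where

      combination : A → Carrier
      combination x = sum (λ i → c i * e i x)

      ∑-combination : ∀ (f : A → Carrier) → (∑[ x ∈ xs ] (combination x * f x)) ≈ sum (λ i → c i * f (κ i))
      ∑-combination f = begin
        (∑[ x ∈ xs ] (combination x * f x))
          ≈⟨ ∑-cong xs (λ x → trans (*-distribʳ-sum (f x) (λ i → c i * e i x))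
               (sum-cong-≋ (λ i → *-assoc (c i) (e i x) (f x)))) ⟩
        (∑[ x ∈ xs ] sum (λ i → c i * (e i x * f x)))
          ≈⟨ ∑-sum-comm xs (λ x i → c i * (e i x * f x)) ⟩
        sum (λ i → ∑[ x ∈ xs ] (c i * (e i x * f x)))
          ≈⟨ sum-cong-≋ (λ i → trans (sym (*-distribˡ-∑ (c i) xs _)) (*-congˡ (∑-e i f))) ⟩
        sum (λ i → c i * f (κ i)) ∎

      -- Fubini for the product measure: with the first letter `x` fixed, its weight factors out and
      -- the other letters fall under the induction hypothesis for `λ τ → G (x ∷ τ)`. The outer sum
      -- over `x` is then evaluated by `∑-combination`.
      expectation-combination : ∀ k (G : Vec A k → Carrier) (H : List A → Carrier) →
        (∀ τ → G τ ≈ H (toList τ)) →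
        (∑[ τ ∈ allVectors xs k ] (product (λ j → combination (lookup τ j)) * G τ))
          ≈ iteratedSum c κ k H
      expectation-combination zero    G H G≈H =
        trans (+-identityʳ _) (trans (*-identityˡ _) (G≈H []))
      expectation-combination (suc k) G H G≈H = begin
        (∑[ τ ∈ allVectors xs (suc k) ] (product (λ j → combination (lookup τ j)) * G τ))
          ≈⟨ ∑-cartesianProductWith _∷_ xs (allVectors xs k) _ ⟩
        (∑[ x ∈ xs ] (∑[ τ ∈ allVectors xs k ]
          (combination x * product (λ j → combination (lookup τ j)) * G (x ∷ τ))))
          ≈⟨ ∑-cong xs (λ x → trans
               (∑-cong (allVectors xs k) (λ τ → *-assoc _ _ _))
               (sym (*-distribˡ-∑ (combination x) (allVectors xs k) _))) ⟩
        (∑[ x ∈ xs ] (combination x *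
          (∑[ τ ∈ allVectors xs k ] (product (λ j → combination (lookup τ j)) * G (x ∷ τ)))))
          ≈⟨ ∑-cong xs (λ x → *-congˡ
               (expectation-combination k (λ τ → G (x ∷ τ)) (λ w → H (x ∷ w)) (λ τ → G≈H (x ∷ τ)))) ⟩
        (∑[ x ∈ xs ] (combination x * iteratedSum c κ k (λ w → H (x ∷ w))))
          ≈⟨ ∑-combination (λ x → iteratedSum c κ k (λ w → H (x ∷ w))) ⟩
        iteratedSum c κ (suc k) H ∎

-- The multinomial theorem for permutation-invariant functions of words

module Multinomial (R : CommutativeSemiring 0ℓ 0ℓ) {ι : ℚ → CommutativeSemiring.Carrier R}
  (ι-homomorphism : IsSemiringHomomorphism ℚ.+-*-rawSemiring (CommutativeSemiring.rawSemiring R) ι)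
  where

  open CommutativeSemiring R hiding (zero)
  open FiniteSums R
  open SemiringSum semiring
    using (sum; sum-cong-≋; sum-init-last; ∑-distrib-+; ∑-comm; *-distribˡ-sum)
  open RawSemiringDefinitions rawSemiring using (product; _^_)
  open CommutativeSemigroupProperties *-commutativeSemigroup using (x∙yz≈y∙xz)
  open CommutativeSemigroupProperties
    (CommutativeMonoid.commutativeSemigroup +-commutativeMonoid)
    using () renaming (x∙yz≈y∙xz to x+yz≈y+xz)
  open IsSemiringHomomorphism ι-homomorphism using (+-homo; *-homo; 0#-homo; 1#-homo)
  open SetoidReasoning setoid

  -- Binomial sums and Pascal's rule

  choose : ℕ → ℕ → Carrier
  choose n k = ι (+ (n C k) ℚ./ 1)

  choose-pascal : ∀ n k → choose (suc n) (suc k) ≈ choose n k + choose n (suc k)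
  choose-pascal n k = trans
    (reflexive (≡.cong ι (≡.trans
      (≡.cong (λ c → + c ℚ./ 1) (≡.sym (nCk+nC[k+1]≡[n+1]C[k+1] n k)))
      (≡.sym (/1-homo-+ (n C k) (n C suc k))))))
    (+-homo _ _)

  choose-> : ∀ n → choose n (suc n) ≈ 0#
  choose-> n = trans
    (reflexive (≡.cong (λ c → ι (+ c ℚ./ 1)) (k>n⇒nCk≡0 (ℕ.n<1+n n)))) 0#-homo

  -- `f` receives `j` and `k ∸ j` as separate arguments, so that raising either exponent alone can
  -- be expressed without subtraction.
  binomialSum : ℕ → (ℕ → ℕ → Carrier) → Carrier
  binomialSum k f = sum {suc k} λ j → choose k (toℕ j) * f (toℕ j) (k ∸ toℕ j)

  binomialSum-cong : ∀ k {f g : ℕ → ℕ → Carrier} → (∀ j l → f j l ≈ g j l) →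
                     binomialSum k f ≈ binomialSum k g
  binomialSum-cong k h = sum-cong-≋ {suc k} λ j →
    *-congˡ {choose k (toℕ j)} (h (toℕ j) (k ∸ toℕ j))

  *-distribˡ-binomialSum : ∀ x k (f : ℕ → ℕ → Carrier) →
    x * binomialSum k f ≈ binomialSum k (λ j l → x * f j l)
  *-distribˡ-binomialSum x k f = trans
    (*-distribˡ-sum {suc k} x (λ j → choose k (toℕ j) * f (toℕ j) (k ∸ toℕ j)))
    (sum-cong-≋ {suc k} λ j → x∙yz≈y∙xz x (choose k (toℕ j)) (f (toℕ j) (k ∸ toℕ j)))

  sum-binomialSum-comm : ∀ {r} k (f : Fin r → ℕ → ℕ → Carrier) →
    sum (λ i → binomialSum k (f i)) ≈ binomialSum k (λ j l → sum (λ i → f i j l))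
  sum-binomialSum-comm k f = trans
    (∑-comm (λ i (j : Fin (suc k)) → choose k (toℕ j) * f i (toℕ j) (k ∸ toℕ j)))
    (sum-cong-≋ {suc k} λ j → sym (*-distribˡ-sum (choose k (toℕ j)) (λ i → f i (toℕ j) (k ∸ toℕ j))))

  sum-last : ∀ n (g : ℕ → Carrier) → sum {suc n} (g ∘ toℕ) ≈ sum {n} (g ∘ toℕ) + g n
  sum-last n g = trans (sum-init-last {n} (g ∘ toℕ))
    (+-cong (sum-cong-≋ {n} λ j → reflexive (≡.cong g (Fin.toℕ-inject₁ j)))
            (reflexive (≡.cong g (Fin.toℕ-fromℕ n))))

  -- The analogue of `(X + Y)^(k+1) = X (X + Y)^k + Y (X + Y)^k`. Detach the term `j = 0` and split
  -- the other coefficients by Pascal's rule: the first halves form the first sum, and the second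
  -- halves together with the detached term form the second.
  binomialSum-pascal : ∀ k (f : ℕ → ℕ → Carrier) →
    binomialSum (suc k) f ≈ binomialSum k (λ j l → f (suc j) l) + binomialSum k (λ j l → f j (suc l))
  binomialSum-pascal k f = begin
    f₀ + sum {suc k} (λ j → choose (suc k) (suc (toℕ j)) * up (toℕ j))
      ≈⟨ +-congˡ (trans
           (sum-cong-≋ {suc k} λ j → trans
             (*-congʳ {up (toℕ j)} (choose-pascal k (toℕ j)))
             (distribʳ (up (toℕ j)) (choose k (toℕ j)) (choose k (suc (toℕ j)))))
           (∑-distrib-+ {suc k} (λ j → choose k (toℕ j) * up (toℕ j)) (λ j → right (suc (toℕ j))))) ⟩
    f₀ + (binomialSum k (λ j l → f (suc j) l) + sum {suc k} (λ j → right (suc (toℕ j))))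
      -- `f₀` is `right 0` by definition, as `suc k C 0` and `k C 0` both compute to 1.
      ≈⟨ x+yz≈y+xz _ _ _ ⟩
    binomialSum k (λ j l → f (suc j) l) + sum {suc (suc k)} (right ∘ toℕ)
      ≈⟨ +-congˡ (begin
           sum {suc (suc k)} (right ∘ toℕ)            ≈⟨ sum-last (suc k) right ⟩
           sum {suc k} (right ∘ toℕ) + right (suc k)  ≈⟨ +-congˡ (trans (*-congʳ (choose-> k)) (zeroˡ _)) ⟩
           sum {suc k} (right ∘ toℕ) + 0#             ≈⟨ +-identityʳ _ ⟩
           -- The identity `suc k ∸ j = suc (k ∸ j)` requires `j` at most `k`, hence the term
           -- `j = k + 1`, whose coefficient `k C (k + 1)` vanishes, is dropped beforehand.
           sum {suc k} (right ∘ toℕ)                  ≈⟨ sum-cong-≋ {suc k} (λ j → reflexive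
                                                           (≡.cong (λ l → choose k (toℕ j) * f (toℕ j) l)
                                                             (ℕ.+-∸-assoc 1 (Fin.toℕ≤pred[n] j)))) ⟩
           binomialSum k (λ j l → f j (suc l))        ∎) ⟩
    binomialSum k (λ j l → f (suc j) l) + binomialSum k (λ j l → f j (suc l)) ∎
    where
    up right : ℕ → Carrier
    up j    = f (suc j) (k ∸ j)
    right j = choose k j * f j (suc k ∸ j)

    f₀ : Carrier
    f₀ = choose (suc k) 0 * f 0 (suc k)

  -- Collecting iterated sums by multiplicity

  module _ {A : Set} where

    PermutationInvariant : (List A → Carrier) → Set
    PermutationInvariant H = ∀ {v w} → v ↭ w → H v ≈ H w

    -- Words are grouped by the number `j` of occurrences of `κ zero`, which invariance gathers at
    -- the front. In the induction on `k`, a first letter `κ zero` raises `j`, any other first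
    -- letter raises the number `l` of remaining letters, and `binomialSum-pascal` merges the two
    -- cases.
    iteratedSum-binomial : ∀ {r} (c : Fin (suc r) → Carrier) (κ : Fin (suc r) → A) k {H : List A → Carrier} →
      PermutationInvariant H →
      iteratedSum c κ k H ≈ binomialSum k (λ j l →
        c zero ^ j * iteratedSum (c ∘ suc) (κ ∘ suc) l (λ w → H (List.replicate j (κ zero) ++ w)))
    iteratedSum-binomial c κ zero {H} inv = sym (begin
      choose 0 0 * (1# * H []) + 0#  ≈⟨ +-identityʳ _ ⟩
      choose 0 0 * (1# * H [])       ≈⟨ *-congʳ 1#-homo ⟩
      1# * (1# * H [])               ≈⟨ *-identityˡ _ ⟩
      1# * H []              ≈⟨ *-identityˡ _ ⟩
      H []                   ∎)
    iteratedSum-binomial {r} c κ (suc k) {H} inv = begin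
      c₀ * iteratedSum c κ k (λ w → H (x ∷ w))
        + sum (λ i → c′ i * iteratedSum c κ k (λ w → H (κ′ i ∷ w)))
        ≈⟨ +-cong first second ⟩
      binomialSum k (λ j l → f (suc j) l) + binomialSum k (λ j l → f j (suc l))
        ≈⟨ binomialSum-pascal k f ⟨
      binomialSum (suc k) f ∎
      where
      c₀ = c zero
      c′ = c ∘ suc
      x  = κ zero
      κ′ = κ ∘ suc

      f : ℕ → ℕ → Carrier
      f j l = c₀ ^ j * iteratedSum c′ κ′ l (λ w → H (List.replicate j x ++ w))

      g : Fin r → ℕ → ℕ → Carrier
      g i j l = iteratedSum c′ κ′ l (λ w → H (κ′ i ∷ List.replicate j x ++ w))

      g′ : Fin r → ℕ → ℕ → Carrier
      g′ i j l = iteratedSum c′ κ′ l (λ w → H (List.replicate j x ++ κ′ i ∷ w))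

      -- Here the symmetry of `H` does its work: the letter `κ′ i` is moved behind the block of
      -- copies of `x`.
      pull : ∀ i j l → c′ i * (c₀ ^ j * g i j l) ≈ c₀ ^ j * (c′ i * g′ i j l)
      pull i j l = trans (x∙yz≈y∙xz _ _ _) (*-congˡ (*-congˡ
        (iteratedSum-cong c′ κ′ l (λ w → inv (↭-sym (shift (κ′ i) (List.replicate j x) w))))))

      first : c₀ * iteratedSum c κ k (λ w → H (x ∷ w)) ≈ binomialSum k (λ j l → f (suc j) l)
      first = begin
        c₀ * iteratedSum c κ k (λ w → H (x ∷ w))
          ≈⟨ *-congˡ (iteratedSum-binomial c κ k (λ v↭w → inv (prep x v↭w))) ⟩
        c₀ * binomialSum k h
          ≈⟨ *-distribˡ-binomialSum c₀ k h ⟩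
        binomialSum k (λ j l → c₀ * h j l)
          ≈⟨ binomialSum-cong k (λ j l → sym (*-assoc c₀ (c₀ ^ j)
               (iteratedSum c′ κ′ l (λ w → H (List.replicate (suc j) x ++ w))))) ⟩
        binomialSum k (λ j l → f (suc j) l) ∎
        where
        h : ℕ → ℕ → Carrier
        h j l = c₀ ^ j * iteratedSum c′ κ′ l (λ w → H (List.replicate (suc j) x ++ w))

      second : sum (λ i → c′ i * iteratedSum c κ k (λ w → H (κ′ i ∷ w)))
                 ≈ binomialSum k (λ j l → f j (suc l))
      second = begin
        sum (λ i → c′ i * iteratedSum c κ k (λ w → H (κ′ i ∷ w)))
          ≈⟨ sum-cong-≋ (λ i → trans
               (*-congˡ (iteratedSum-binomial c κ k (λ v↭w → inv (prep (κ′ i) v↭w))))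
               (*-distribˡ-binomialSum (c′ i) k (λ j l → c₀ ^ j * g i j l))) ⟩
        sum (λ i → binomialSum k (λ j l → c′ i * (c₀ ^ j * g i j l)))
          ≈⟨ sum-binomialSum-comm k (λ i j l → c′ i * (c₀ ^ j * g i j l)) ⟩
        binomialSum k (λ j l → sum (λ i → c′ i * (c₀ ^ j * g i j l)))
          -- `sum (λ i → c′ i * g′ i j l)` is by definition the iterated sum of depth `suc l`
          -- occurring in `f j (suc l)`.
          ≈⟨ binomialSum-cong k (λ j l → trans
               (sum-cong-≋ (λ i → pull i j l))
               (sym (*-distribˡ-sum (c₀ ^ j) (λ i → c′ i * g′ i j l)))) ⟩
        binomialSum k (λ j l → f j (suc l)) ∎

    -- Induction on the number of points: `iteratedSum-binomial` fixes the multiplicity `j` of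
    -- `κ zero`, and the hypothesis treats the other points with `k ∸ j` letters. This matches
    -- `tuples`, which enumerates by first entry.
    iteratedSum-multinomial : ∀ {r} (c : Fin r → Carrier) (κ : Fin r → A) k {H : List A → Carrier} →
      PermutationInvariant H →
      iteratedSum c κ k H ≈ (∑[ t ∈ tuples r k ]
        (ι (multinomialℚ t) * product (λ i → c i ^ lookup (entries t) i) * H (toList (powerWord κ t))))
    iteratedSum-multinomial {zero} c κ zero {H} inv = sym (begin
      ι 1ℚ * 1# * H [] + 0#  ≈⟨ +-identityʳ _ ⟩
      ι 1ℚ * 1# * H []       ≈⟨ *-congʳ (*-congʳ 1#-homo) ⟩
      1# * 1# * H []         ≈⟨ *-congʳ (*-identityˡ 1#) ⟩
      1# * H []              ≈⟨ *-identityˡ _ ⟩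
      H []                   ∎)
    -- Without points there is neither a word of positive length nor a tuple of positive sum; both
    -- sides are `0#`.
    iteratedSum-multinomial {zero}  c κ (suc k) inv = refl
    iteratedSum-multinomial {suc r} c κ k {H} inv = begin
      iteratedSum c κ k H
        ≈⟨ iteratedSum-binomial c κ k inv ⟩
      sum {suc k} (λ j → choose k (toℕ j) * (c₀ ^ toℕ j *
        iteratedSum c′ κ′ (k ∸ toℕ j) (λ w → H (List.replicate (toℕ j) x ++ w))))
        ≈⟨ sum-cong-≋ {suc k} splitFirst ⟩
      sum {suc k} (λ j → ∑ (List.map (consTuple j) (tuples r (k ∸ toℕ j))) term)
        ≡⟨ ∑-tabulate (λ j → j) (λ j → ∑ (List.map (consTuple j) (tuples r (k ∸ toℕ j))) term) ⟨
      (∑[ j ∈ allFin (suc k) ] ∑ (List.map (consTuple j) (tuples r (k ∸ toℕ j))) term)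
        ≈⟨ ∑-concatMap (λ j → List.map (consTuple j) (tuples r (k ∸ toℕ j))) (allFin (suc k)) term ⟨
      ∑ (tuples (suc r) k) term ∎
      where
      c₀ = c zero
      c′ = c ∘ suc
      x  = κ zero
      κ′ = κ ∘ suc

      term : Tuple (suc r) k → Carrier
      term t = ι (multinomialℚ t) * product (λ i → c i ^ lookup (entries t) i) * H (toList (powerWord κ t))

      term-consTuple : ∀ (j : Fin (suc k)) (t : Tuple r (k ∸ toℕ j)) →
        choose k (toℕ j) * (c₀ ^ toℕ j *
          (ι (multinomialℚ t) * product (λ i → c′ i ^ lookup (entries t) i)
            * H (List.replicate (toℕ j) x ++ toList (powerWord κ′ t))))
          ≈ term (consTuple j t)
      term-consTuple j t@(mkTuple _ _) = begin
        C * (p * (M * P * h))    ≈⟨ *-congˡ (*-assoc _ _ _) ⟨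
        -- The rearrangement pairs `C` with `M` into the multinomial coefficient of the longer
        -- tuple, and `p` with `P` into its product of powers.
        C * (p * (M * P) * h)    ≈⟨ *-assoc _ _ _ ⟨
        C * (p * (M * P)) * h    ≈⟨ *-congʳ (*-congˡ (x∙yz≈y∙xz _ _ _)) ⟩
        C * (M * (p * P)) * h    ≈⟨ *-congʳ (*-assoc _ _ _) ⟨
        C * M * (p * P) * h      ≈⟨ *-cong (*-congʳ (sym weight-consTuple))
                                      (reflexive (≡.cong H (≡.sym (toList-powerWord-consTuple κ j t)))) ⟩
        term (consTuple j t)     ∎
        where
        C = choose k (toℕ j)
        p = c₀ ^ toℕ j
        M = ι (multinomialℚ t)
        P = product (λ i → c′ i ^ lookup (entries t) i)
        h = H (List.replicate (toℕ j) x ++ toList (powerWord κ′ t))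

        weight-consTuple : ι (multinomialℚ (consTuple j t)) ≈ C * M
        weight-consTuple =
          trans (reflexive (≡.cong ι (multinomialℚ-consTuple j t))) (*-homo _ _)

      splitFirst : ∀ (j : Fin (suc k)) →
        choose k (toℕ j) * (c₀ ^ toℕ j *
          iteratedSum c′ κ′ (k ∸ toℕ j) (λ w → H (List.replicate (toℕ j) x ++ w)))
          ≈ ∑ (List.map (consTuple j) (tuples r (k ∸ toℕ j))) term
      splitFirst j = begin
        _ ≈⟨ *-congˡ (*-congˡ (iteratedSum-multinomial c′ κ′ (k ∸ toℕ j)
               (λ v↭w → inv (++⁺ˡ (List.replicate (toℕ j) x) v↭w)))) ⟩
        choose k (toℕ j) * (c₀ ^ toℕ j * ∑ ts _)
          ≈⟨ *-congˡ (*-distribˡ-∑ (c₀ ^ toℕ j) ts _) ⟩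
        choose k (toℕ j) * ∑ ts _
          ≈⟨ *-distribˡ-∑ (choose k (toℕ j)) ts _ ⟩
        ∑ ts _
          ≈⟨ ∑-cong ts (term-consTuple j) ⟩
        ∑ ts (term ∘ consTuple j)
          ≡⟨ ∑-map (consTuple j) ts term ⟨
        ∑ (List.map (consTuple j) ts) term ∎
        where ts = tuples r (k ∸ toℕ j)

-- The real numbers

open import Defs

-- Reduces the semiring laws of ℝ to those of ℚ, term by term; the Cauchy proofs do not enter `_≈_`.
pointwise : ∀ {x y} → (∀ i → seq x i ≡ seq y i) → x ≈ y
pointwise {x} {y} h = mk≈ λ {ε} 0<ε → 0 , λ {i} _ →
  ≡.subst (ℚ._< ε)
    (≡.sym (≡.cong ∣_∣ (≡.trans (≡.cong (ℚ._- seq y i) (h i)) (ℚ.+-inverseʳ (seq y i))))) 0<ε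

≈-refl : ∀ {x} → x ≈ x
≈-refl = pointwise λ _ → ≡.refl

≈-sym : ∀ {x y} → x ≈ y → y ≈ x
≈-sym {x} {y} (mk≈ h) = mk≈ λ {ε} 0<ε → let N , p = h 0<ε in
  N , λ {i} N≤i → ≡.subst (ℚ._< ε) (∣p-q∣≡∣q-p∣ (seq x i) (seq y i)) (p N≤i)

≈-trans : ∀ {x y z} → x ≈ y → y ≈ z → x ≈ z
≈-trans {x} {y} {z} (mk≈ h) (mk≈ k) = mk≈ λ {ε} 0<ε →
  let M , p = h (half-pos 0<ε)
      N , q = k (half-pos 0<ε)
  -- The triangle inequality is obtained from `+-near` by placing the middle term `y` in both sums,
  -- where it cancels.
  in M ℕ.⊔ N , λ {i} le → ≡.subst (ℚ._< ε)
       (≡.cong ∣_∣ (telescope (seq x i) (seq y i) (seq z i)))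
       (+-near (seq x i) (seq y i) (seq y i) (seq z i)
         (p (ℕ.m⊔n≤o⇒m≤o M N le)) (q (ℕ.m⊔n≤o⇒n≤o M N le)))
  where
  telescope : ∀ a b c → (a ℚ.+ b) ℚ.- (b ℚ.+ c) ≡ a ℚ.- c
  telescope = solve 3 (λ a b c → (a :+ b) :- (b :+ c) := a :- c) ≡.refl
    where open ℚ.+-*-Solver

+-cong-≈ : ∀ {x x′ y y′} → x ≈ x′ → y ≈ y′ → x + y ≈ x′ + y′
+-cong-≈ {x} {x′} {y} {y′} (mk≈ h) (mk≈ k) = mk≈ λ 0<ε →
  let M , p = h (half-pos 0<ε)
      N , q = k (half-pos 0<ε)
  in M ℕ.⊔ N , λ {i} le → +-near (seq x i) (seq y i) (seq x′ i) (seq y′ i)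
       (p (ℕ.m⊔n≤o⇒m≤o M N le)) (q (ℕ.m⊔n≤o⇒n≤o M N le))

-- Since `x * y - x′ * y′ = x * (y - y′) + y′ * (x - x′)`, the bounds are taken for `x` and `y′`.
*-cong-≈ : ∀ {x x′ y y′} → x ≈ x′ → y ≈ y′ → x * y ≈ x′ * y′
*-cong-≈ {x} {x′} {y} {y′} (mk≈ h) (mk≈ k) = mk≈ λ 0<ε →
  let A , 0<A , K , hA = eventually-bounded x
      B , 0<B , L , hB = eventually-bounded y′
      δ , 0<δ , small  = *-modulus (A ℚ.⊔ B) (ℚ.<-≤-trans 0<A (ℚ.p≤p⊔q A B)) 0<ε
      M , p = h 0<δ
      N , q = k 0<δ
      KL = K ℕ.⊔ L
      MN = M ℕ.⊔ N
  in KL ℕ.⊔ MN , λ {i} le →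
       let le₁ = ℕ.m⊔n≤o⇒m≤o KL MN le
           le₂ = ℕ.m⊔n≤o⇒n≤o KL MN le
       in small (seq x i) (seq y i) (seq x′ i) (seq y′ i)
            (ℚ.<-≤-trans (hA (ℕ.m⊔n≤o⇒m≤o K L le₁)) (ℚ.p≤p⊔q A B))
            (ℚ.<-≤-trans (hB (ℕ.m⊔n≤o⇒n≤o K L le₁)) (ℚ.p≤q⊔p A B))
            (p (ℕ.m⊔n≤o⇒m≤o M N le₂))
            (q (ℕ.m⊔n≤o⇒n≤o M N le₂))

ℝ-commutativeSemiring : CommutativeSemiring 0ℓ 0ℓ
ℝ-commutativeSemiring = record
  { Carrier = ℝ
  ; _≈_     = _≈_
  ; _+_     = _+_
  ; _*_     = _*_
  ; 0#      = 0ℝ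
  ; 1#      = 1ℝ
  ; isCommutativeSemiring = isCommutativeSemiringˡ record
    { +-isCommutativeMonoid = isCommutativeMonoidˡ record
      { isSemigroup = record
        { isMagma = record { isEquivalence = isEquivalence ; ∙-cong = +-cong-≈ }
        ; assoc   = λ x y z → pointwise λ i → ℚ.+-assoc (seq x i) (seq y i) (seq z i)
        }
      ; identityˡ = λ x → pointwise λ i → ℚ.+-identityˡ (seq x i)
      ; comm      = λ x y → pointwise λ i → ℚ.+-comm (seq x i) (seq y i)
      }
    ; *-isCommutativeMonoid = isCommutativeMonoidˡ record
      { isSemigroup = record
        { isMagma = record { isEquivalence = isEquivalence ; ∙-cong = *-cong-≈ }
        ; assoc   = λ x y z → pointwise λ i → ℚ.*-assoc (seq x i) (seq y i) (seq z i)
        }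
      ; identityˡ = λ x → pointwise λ i → ℚ.*-identityˡ (seq x i)
      ; comm      = λ x y → pointwise λ i → ℚ.*-comm (seq x i) (seq y i)
      }
    ; distribʳ = λ z x y → pointwise λ i → ℚ.*-distribʳ-+ (seq z i) (seq x i) (seq y i)
    ; zeroˡ    = λ x → pointwise λ i → ℚ.*-zeroˡ (seq x i)
    }
  }
  where
  isEquivalence : IsEquivalence _≈_
  isEquivalence = record { refl = ≈-refl ; sym = ≈-sym ; trans = ≈-trans }

fromℚ-homomorphism :
  IsSemiringHomomorphism ℚ.+-*-rawSemiring (CommutativeSemiring.rawSemiring ℝ-commutativeSemiring) fromℚ
fromℚ-homomorphism = record
  { isNearSemiringHomomorphism = record
    { +-isMonoidHomomorphism = record
      { isMagmaHomomorphism = record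
        { isRelHomomorphism = record { cong = λ { ≡.refl → ≈-refl } }
        ; homo              = λ _ _ → ≈-refl′
        }
      ; ε-homo = ≈-refl
      }
    ; *-homo = λ _ _ → ≈-refl′
    }
  ; 1#-homo = ≈-refl
  }
  where
  -- A sum or product of constants is again the constant sequence, but carries a different Cauchy
  -- proof; hence the arbitrary `h`.
  ≈-refl′ : ∀ {p} {h : Cauchy (λ _ → p)} → fromℚ p ≈ mkℝ (λ _ → p) h
  ≈-refl′ = pointwise λ _ → ≡.refl

open CommutativeSemiring ℝ-commutativeSemiring
  using (setoid; trans; sym; reflexive; +-cong; +-congˡ; *-congˡ; *-identityˡ; zeroˡ; +-identityˡ; +-identityʳ)
open FiniteSums ℝ-commutativeSemiring
  using (∑-cong; ∑-zero; ∑-cartesianProductWith; iteratedSum; expectation-combination)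
open Multinomial ℝ-commutativeSemiring fromℚ-homomorphism
  using (PermutationInvariant; iteratedSum-multinomial)
open SetoidReasoning setoid

-- Point masses, functions on lists, and the expectation formula

∑-e : ∀ {m} (κ : 𝓛 m) (f : 𝓛 m → ℝ) → (∑[ l ∈ all𝓛 m ] (e κ l * f l)) ≈ f κ
∑-e []      f = trans (+-identityʳ _) (*-identityˡ _)
∑-e {suc m} (a ∷ κ) f = begin
  (∑[ l ∈ all𝓛 (suc m) ] (e (a ∷ κ) l * f l))
    ≈⟨ ∑-cartesianProductWith _∷_ (false ∷ true ∷ []) (all𝓛 m) _ ⟩
  slice a false + (slice a true + 0ℝ)
    ≈⟨ +-congˡ (+-identityʳ _) ⟩
  slice a false + slice a true
    ≈⟨ slices a ⟩
  f (a ∷ κ) ∎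
  where
  slice : Bool → Bool → ℝ
  slice a c = ∑[ l ∈ all𝓛 m ] (e (a ∷ κ) (c ∷ l) * f (c ∷ l))

  slices : ∀ a → slice a false + slice a true ≈ f (a ∷ κ)
  -- The comparison of bit vectors computes on the leading bits: in the agreeing half `e (a ∷ κ)`
  -- reduces to `e κ`, in the other half to `0ℝ`.
  slices false = trans (+-cong (∑-e κ (f ∘ (false ∷_))) (∑-zero (all𝓛 m) _ (λ _ → zeroˡ _)))
    (+-identityʳ _)
  slices true  = trans (+-cong (∑-zero (all𝓛 m) _ (λ _ → zeroˡ _)) (∑-e κ (f ∘ (true ∷_))))
    (+-identityˡ _)

-- The value 0ℝ on lists of the wrong length is arbitrary.
onLists : ∀ {m k} → (Word m k → ℝ) → List (𝓛 m) → ℝ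
onLists {k = k} G w with List.length w ℕ.≟ k
... | yes eq = G (cast eq (fromList w))
... | no  _  = 0ℝ

toList-cast-fromList : ∀ {A : Set} {k} (w : List A) .(eq : List.length w ≡ k) →
                       toList (cast eq (fromList w)) ≡ w
toList-cast-fromList w eq = ≡.trans (Vec.toList-cast eq (fromList w)) (Vec.toList∘fromList w)

onLists-toList : ∀ {m k} (G : Word m k → ℝ) (τ : Word m k) → G τ ≈ onLists G (toList τ)
onLists-toList {k = k} G τ with List.length (toList τ) ℕ.≟ k
... | yes eq  = reflexive (≡.cong G (≡.sym
                  (Vec.toList-injective eq _ τ (Vec.toList∘fromList (toList τ)))))
... | no  neq = contradiction (Vec.length-toList τ) neq

-- A permutation preserves length, so the two lists pass or fail the length test together.
onLists-invariant : ∀ {m k} {G : Word m k → ℝ} → Symmetric G → PermutationInvariant (onLists G)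
onLists-invariant {k = k} sym-G {v} {w} v↭w with List.length v ℕ.≟ k | List.length w ℕ.≟ k
... | yes p | yes q = sym-G _ _ (↭-trans (↭-reflexive (toList-cast-fromList v p))
                        (↭-trans v↭w (↭-reflexive (≡.sym (toList-cast-fromList w q)))))
... | yes p | no ¬q = contradiction (≡.trans (≡.sym (↭-length v↭w)) p) ¬q
... | no ¬p | yes q = contradiction (≡.trans (↭-length v↭w) q) ¬p
... | no _  | no _  = ≈-refl

-- Both claims of the theorem are instances. `G` is extended to lists, where words are permuted and
-- split without casts, and recovered on the power words at the end.
𝔼-multinomial : ∀ {m r} (c : Fin r → ℝ) (κ : Fin r → 𝓛 m) k (G : Word m k → ℝ) → Symmetric G →
  𝔼 (λ l → sum (λ i → c i * e (κ i) l)) G ≈ (∑[ t ∈ tuples r k ]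
    (multinomial t * product (λ i → c i ^ lookup (entries t) i) * G (powerWord κ t)))
𝔼-multinomial {m} {r} c κ k G sym-G = begin
  𝔼 (λ l → sum (λ i → c i * e (κ i) l)) G
    ≈⟨ expectation-combination (all𝓛 m) c κ (λ i → e (κ i)) (λ i → ∑-e (κ i)) k G (onLists G)
         (onLists-toList G) ⟩
  iteratedSum c κ k (onLists G)
    ≈⟨ iteratedSum-multinomial c κ k (onLists-invariant sym-G) ⟩
  ∑ (tuples r k) (λ t → weight t * onLists G (toList (powerWord κ t)))
    ≈⟨ ∑-cong (tuples r k) (λ t → *-congˡ {weight t} (≈-sym (onLists-toList G (powerWord κ t)))) ⟩
  ∑ (tuples r k) (λ t → weight t * G (powerWord κ t)) ∎
  where
  weight : Tuple r k → ℝ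
  weight t = multinomial t * product (λ i → c i ^ lookup (entries t) i)

-- Permuting the tail permutes the whole word, with the prefix `ω` left in place.
restrict-symmetric : ∀ {m n k} (F : Word m n → ℝ) .(k≤n : k ℕ.≤ n) (ω : Word m (n ∸ k)) →
  Symmetric F → Symmetric (restrict F k≤n ω)
restrict-symmetric F k≤n ω sym-F v w v↭w = sym-F _ _
  (↭-trans (↭-reflexive (prefixed v))
  (↭-trans (++⁺ˡ (toList ω) v↭w) (↭-reflexive (≡.sym (prefixed w)))))
  where
  prefixed : ∀ u → toList (cast (ℕ.m∸n+n≡m k≤n) (ω Vec.++ u)) ≡ toList ω ++ toList u
  prefixed u = ≡.trans (Vec.toList-cast _ (ω Vec.++ u)) (Vec.toList-++ ω u)

proposition1p11 : (m n : ℕ) → 1 ℕ.≤ m → 1 ℕ.≤ n →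
    (b : Vec ℝ m) → (∀ (i : Fin m) → - 1ℝ ≤ lookup b i × lookup b i ≤ 1ℝ) →
    (F : Word m n → ℝ) → TruncatedℓPositive F → Symmetric F →
    (k : ℕ) (k≤n : k ℕ.≤ n) (ω : Word m (n ∸ k)) →
    (Decreasing b →
    𝔼 (supervertex b) (restrict F k≤n ω)
    ≈ (∑[ i ∈ tuples (suc m) k ]
    (multinomial i * product (λ j → b′ b j ^ lookup (entries i) j)
    * restrict F k≤n ω (powerWord μ i))))
    ×
    (subvertex b ∈P b →
    𝔼 (subvertex b) (restrict F k≤n ω)
    ≈ (∑[ i ∈ tuples (suc m) k ]
    (multinomial i * product (λ j → b″ b j ^ lookup (entries i) j)
    * restrict F k≤n ω (powerWord ν i))))
proposition1p11 m n _ _ b _ F _ sym-F k k≤n ω =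
  -- `supervertex b` and `subvertex b` unfold to combinations of point masses at the `μ i` and the
  -- `ν i`, with weights `b′ b` and `b″ b`.
  (λ _ → 𝔼-multinomial (b′ b) μ k (restrict F k≤n ω) sym-G) ,
  (λ _ → 𝔼-multinomial (b″ b) ν k (restrict F k≤n ω) sym-G)
  where
  sym-G : Symmetric (restrict F k≤n ω)
  sym-G = restrict-symmetric F k≤n ω sym-F
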